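{- Let $q\ge 5$ and $d\ge 0$ be integers, and let $T$ be the complete $q$-ary tree of depth $d$. Then $\Phi_V(T)=d$.
   Context: The complete $q$-ary tree of depth $d$ is the rooted tree in which every vertex at distance less than $d$ from the root has exactly $q$ children, and the vertices at distance $d$ from the root are leaves. For a graph $G$ and $S\subseteq V(G)$, the vertex-border is $\delta(S)=\{v\in V(G)\setminus S : N(v)\cap S\neq\emptyset\}$. The vertex-isoperimetric parameter is $\Phi_V(G,s)=\min_{S\subseteq V(G),\,|S|=s}|\delta(S)|$, and the vertex-isoperimetric peak is $\Phi_V(G)=\max_{0\le s\le |V(G)|}\Phi_V(G,s)$. -}

module Defs where

open import Data.Nat using (ℕ; zero; suc; _+_; _*_; _^_; _≤_; _<ᵇ_; _≤ᵇ_)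
open import Data.Bool using (Bool; true; false; _∧_; _∨_; not)
open import Data.Fin using (Fin; toℕ)
open import Data.Fin.Subset using (Subset; ∣_∣)
open import Data.Vec using (tabulate; lookup)
open import Data.Product using (Σ; ∃; _×_)
open import Relation.Binary.PropositionalEquality using (_≡_)

-- Generic finite simple graphs on vertex set Fin n, given by a
-- Bool-valued (symmetric) adjacency relation.

anyFin : ∀ {n} → (Fin n → Bool) → Bool
anyFin {zero}  f = false
anyFin {suc n} f = f Fin.zero ∨ anyFin (λ i → f (Fin.suc i))

border : ∀ {n} → (Fin n → Fin n → Bool) → Subset n → Subset n
border adj S = tabulate λ v →
  not (lookup S v) ∧ anyFin (λ u → lookup S u ∧ adj u v)

IsPhiV : ∀ {n} → (Fin n → Fin n → Bool) → ℕ → ℕ → Set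
IsPhiV {n} adj s m =
  (Σ (Subset n) λ S → (∣ S ∣ ≡ s) × (∣ border adj S ∣ ≡ m))
  × (∀ (S : Subset n) → ∣ S ∣ ≡ s → m ≤ ∣ border adj S ∣)

IsPhiVPeak : ∀ {n} → (Fin n → Fin n → Bool) → ℕ → Set
IsPhiVPeak {n} adj p =
  (Σ ℕ λ s → (s ≤ n) × IsPhiV adj s p)
  × (∀ s m → s ≤ n → IsPhiV adj s m → m ≤ p)

-- Complete q-ary tree of depth d, heap-indexed:
-- the root is 0, and the children of vertex k are q*k+1, …, q*k+q.
-- Number of vertices: 1 + q + … + q^d.

treeSize : ℕ → ℕ → ℕ
treeSize q zero    = 1
treeSize q (suc d) = treeSize q d + q ^ suc d

parentB : ℕ → ℕ → ℕ → Bool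
parentB q u v = (q * u <ᵇ v) ∧ (v ≤ᵇ q * u + q)

treeAdj : (q d : ℕ) → Fin (treeSize q d) → Fin (treeSize q d) → Bool
treeAdj q d u v = parentB q (toℕ u) (toℕ v) ∨ parentB q (toℕ v) (toℕ u)

{-# OPTIONS --safe #-}
module Submission where

open import Defs
open import Data.Bool using (Bool; true; false; T; _∧_; _∨_; not)
open import Data.Empty using (⊥-elim)
open import Data.Fin using (Fin; toℕ; fromℕ<)
open import Data.Fin.Properties using (toℕ-fromℕ<)
open import Data.Fin.Subset using (Subset; ∣_∣)
open import Data.Nat
open import Data.Nat.Properties
open import Algebra.Properties.CommutativeSemigroup +-commutativeSemigroup using (interchange)
open import Data.Nat.Solver using (module +-*-Solver)
open +-*-Solver using (solve; con; _:+_; _:*_; _:=_)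
open import Data.Product using (∃; _×_; _,_; proj₁; proj₂)
open import Data.Sum using (_⊎_; inj₁; inj₂)
open import Data.Unit using (tt)
open import Data.Vec using ([]; _∷_; _++_; lookup)
open import Data.Vec.Properties using (lookup∘tabulate)
open import Function using (_∘_)
open import Relation.Binary.PropositionalEquality
open import Relation.Nullary using (¬_; yes; no)

-- Upper bound: an initial segment of the postorder has at most one border vertex on each
-- non-leaf level, namely the next vertex of that level.
--
-- Lower bound: let σᵢ and βᵢ count S and its border on level i.  Children and parents of S lie
-- in S or its border, so q σᵢ ≤ σᵢ₊₁ + βᵢ₊₁ and σᵢ₊₁ ≤ q (σᵢ + βᵢ), and the intervals
-- [σᵢ₊₁, σᵢ₊₁ + βᵢ₊₁] and [q σᵢ, q (σᵢ + βᵢ)] share a point Rᵢ₊₁.  Take |S| = Σ xᵢ with x₀ = 0 and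
-- xᵢ₊₁ = q xᵢ + 2.  A level without border vertices multiplies the deviation of R from x by
-- about q, which costs later levels extra border vertices.  With g the deviation,
-- E = Σ (βₖ − 1) and u = Σ (xₖ − σₖ) over k < i, the invariants are u ≤ 2E + g and −u ≤ E + g;
-- on the last level they force Σ βᵢ ≥ d.  The constant 2 needs 2 and q − 3 to be at least 2,
-- which is where q ≥ 5 enters.

-- Linear inequalities over the naturals and finite sums

infixr 5 _⊕_
_⊕_ : ∀ {a b c d} → a ≤ b → c ≤ d → a + c ≤ b + d
_⊕_ = +-mono-≤

-- A certificate for linear arithmetic without subtraction: the hypotheses are added up to `a ≤ b`,
-- `e` is the slack left over, and the remaining identity goes to the ring solver. With `c` and `d`
-- equal to 1 and 0 it refutes an impossible case.
linear-≤ : ∀ {a b c d} e → a ≤ b → c + b + e ≡ d + a → c ≤ d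
linear-≤ {a} {b} {c} {d} e a≤b eq = +-cancelʳ-≤ b c d (begin
  c + b      ≤⟨ m≤m+n (c + b) e ⟩
  c + b + e  ≡⟨ eq ⟩
  d + a      ≤⟨ +-monoʳ-≤ d a≤b ⟩
  d + b      ∎)
  where open ≤-Reasoning

sum< : (ℕ → ℕ) → ℕ → ℕ
sum< f zero    = 0
sum< f (suc n) = sum< f n + f n

sum<-suc : ∀ f n → sum< f (suc n) ≡ f 0 + sum< (f ∘ suc) n
sum<-suc f zero    = sym (+-identityʳ (f 0))
sum<-suc f (suc n) = trans (cong (_+ f (suc n)) (sum<-suc f n)) (+-assoc (f 0) _ _)

sum<-mono : ∀ f g n → (∀ i → i < n → f i ≤ g i) → sum< f n ≤ sum< g n
sum<-mono f g zero    le = z≤n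
sum<-mono f g (suc n) le =
  sum<-mono f g n (λ i i<n → le i (m≤n⇒m≤1+n i<n)) ⊕ le n ≤-refl

-- The arithmetic of level profiles

-- In closed form 2(1 + q + ... + q^(i-1)), about the fraction 2/(q - 1) of level i.
profile : ℕ → ℕ → ℕ
profile q zero    = 0
profile q (suc i) = q * profile q i + 2

-- g = |x − R + 1/2| − 1/2, the distance for which R ≤ x and R > x play symmetric roles.
Dist : ℕ → ℕ → ℕ → Set
Dist x R g = (x ≡ R + g) ⊎ (R ≡ suc (x + g))

dist : ∀ x R → ∃ (Dist x R)
dist x R with R ≤? x
... | yes R≤x = x ∸ R , inj₁ (sym (m+[n∸m]≡n R≤x))
... | no  R≰x = R ∸ suc x , inj₂ (sym (m+[n∸m]≡n (≰⇒> R≰x)))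

private
  variable
    q x R R′ σ β g g′ : ℕ

-- A shortfall `w` grows to at least `q * w + 2` on the next level. `gain` applies this with `σ + β`
-- in the place of `σ`.
dist-below : ∀ w → 5 ≤ q → R′ ≤ q * σ → Dist (q * (σ + w) + 2) R′ g′ → 5 * w + 2 ≤ g′
dist-below {q} {R′} {σ} {g′} w 5≤q R′≤ (inj₁ eq) =
  linear-≤ 0 (*-monoˡ-≤ w 5≤q ⊕ R′≤ ⊕ ≤-reflexive eq)
    (solve 5 (λ q R′ σ g′ w →
      con 5 :* w :+ con 2 :+ (q :* w :+ (q :* σ :+ (R′ :+ g′))) :+ con 0
      := g′ :+ (con 5 :* w :+ (R′ :+ (q :* (σ :+ w) :+ con 2)))) refl q R′ σ g′ w)
dist-below {q} {R′} {σ} {g′} w 5≤q R′≤ (inj₂ refl) =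
  ⊥-elim (1+n≰n {0} (linear-≤ (q * w + 2 + g′) R′≤
    (solve 4 (λ q σ g′ w →
      con 1 :+ q :* σ :+ (q :* w :+ con 2 :+ g′)
      := con 0 :+ (con 1 :+ (q :* (σ :+ w) :+ con 2 :+ g′))) refl q σ g′ w)))

-- An excess `1 + w` becomes at least q(1 + w) - 2, and `Dist` takes off one more. What remains is
-- qw + (q - 3), so q ≥ 5 gives the same bound as on the other side.
dist-above : ∀ w → 5 ≤ q → q * (suc x + w) ≤ R′ → Dist (q * x + 2) R′ g′ → 5 * w + 2 ≤ g′
dist-above {q} {x} {R′} {g′} w 5≤q ≤R′ (inj₁ eq) =
  ⊥-elim (1+n≰n {0} (linear-≤ (q * w + g′ + 2)
    (5≤q ⊕ ≤R′ ⊕ ≤-reflexive (sym eq))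
      (solve 5 (λ q x R′ g′ w →
        con 1 :+ (q :+ (R′ :+ (q :* x :+ con 2))) :+ (q :* w :+ g′ :+ con 2)
        := con 0 :+ (con 5 :+ (q :* (con 1 :+ x :+ w) :+ (R′ :+ g′)))) refl q x R′ g′ w)))
dist-above {q} {x} {R′} {g′} w 5≤q ≤R′ (inj₂ refl) =
  linear-≤ 0 (*-monoˡ-≤ (suc w) 5≤q ⊕ ≤R′)
    (solve 4 (λ q x g′ w →
      con 5 :* w :+ con 2 :+ (q :* (con 1 :+ w) :+ (con 1 :+ (q :* x :+ con 2 :+ g′))) :+ con 0
      := g′ :+ (con 5 :* (con 1 :+ w) :+ q :* (con 1 :+ x :+ w))) refl q x g′ w)

-- The change of the invariants over one level

module _ (5≤q : 5 ≤ q) (σ≤R : σ ≤ R) (R≤σ+β : R ≤ σ + β)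
         (qσ≤R′ : q * σ ≤ R′) (R′≤q[σ+β] : R′ ≤ q * (σ + β)) where

  -- What one level adds to `inv₁` and `inv₂`. With subtraction: x - σ ≤ 2(β - 1) + (g′ - g) and σ -
  -- x ≤ (β - 1) + (g′ - g).
  Gain : ℕ → ℕ → ℕ → Set
  Gain x g g′ = (g + x + 2 ≤ 2 * β + g′ + σ) × (g + σ + 1 ≤ β + g′ + x)

  -- The border of this level pays: both `g` and x - σ are at most β - 1, because `R` and `x` lie
  -- between `σ` and `σ + β`.
  gain-inside : σ ≤ x → x < σ + β → Dist x R g → Gain x g g′
  gain-inside {x} {g} {g′} σ≤x x<σ+β (inj₁ refl) =
      linear-≤ g′ (σ≤R ⊕ x<σ+β ⊕ x<σ+β)
        (solve 5 (λ σ β R g g′ →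
          g :+ (R :+ g) :+ con 2 :+ (R :+ (σ :+ β :+ (σ :+ β))) :+ g′
          := con 2 :* β :+ g′ :+ σ :+ (σ :+ (con 1 :+ (R :+ g) :+ (con 1 :+ (R :+ g)))))
         refl σ β R g g′)
    , linear-≤ (g′ + g) (σ≤R ⊕ σ≤R ⊕ x<σ+β)
        (solve 5 (λ σ β R g g′ →
          g :+ σ :+ con 1 :+ (R :+ (R :+ (σ :+ β))) :+ (g′ :+ g)
          := β :+ g′ :+ (R :+ g) :+ (σ :+ (σ :+ (con 1 :+ (R :+ g))))) refl σ β R g g′)
  gain-inside {x} {g} {g′} σ≤x x<σ+β (inj₂ refl) =
      linear-≤ g′ (R≤σ+β ⊕ σ≤x ⊕ x<σ+β)
        (solve 5 (λ σ β x g g′ →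
          g :+ x :+ con 2 :+ (σ :+ β :+ (x :+ (σ :+ β))) :+ g′
          := con 2 :* β :+ g′ :+ σ :+ (con 1 :+ (x :+ g) :+ (σ :+ (con 1 :+ x)))) refl σ β x g g′)
    , linear-≤ g′ (R≤σ+β ⊕ σ≤x ⊕ σ≤x)
        (solve 5 (λ σ β x g g′ →
          g :+ σ :+ con 1 :+ (σ :+ β :+ (x :+ x)) :+ g′
          := β :+ g′ :+ x :+ (con 1 :+ (x :+ g) :+ (σ :+ σ))) refl σ β x g g′)

  -- The next gap pays: x - σ equals β + w and `g` is at most that, so the first inequality costs at
  -- most 2β + 2w + 2, which 2β + g′ covers.
  gain-above : ∀ w → x ≡ σ + β + w → Dist x R g → 5 * w + 2 ≤ g′ → Gain x g g′
  gain-above {x} {g} {g′} w refl (inj₁ eq) far =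
      linear-≤ (3 * w) (σ≤R ⊕ ≤-reflexive (sym eq) ⊕ far)
        (solve 6 (λ σ β R g g′ w →
          g :+ (σ :+ β :+ w) :+ con 2 :+ (R :+ (σ :+ β :+ w :+ g′)) :+ con 3 :* w
          := con 2 :* β :+ g′ :+ σ :+ (σ :+ (R :+ g :+ (con 5 :* w :+ con 2)))) refl σ β R g g′ w)
    , linear-≤ (β + 1 + 5 * w) (σ≤R ⊕ ≤-reflexive (sym eq) ⊕ far)
        (solve 6 (λ σ β R g g′ w →
          g :+ σ :+ con 1 :+ (R :+ (σ :+ β :+ w :+ g′)) :+ (β :+ con 1 :+ con 5 :* w)
          := β :+ g′ :+ (σ :+ β :+ w) :+ (σ :+ (R :+ g :+ (con 5 :* w :+ con 2))))
         refl σ β R g g′ w)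
  gain-above {x} {g} {g′} w refl (inj₂ refl) far =
    ⊥-elim (1+n≰n {0} (linear-≤ (w + g) R≤σ+β
      (solve 4 (λ σ β g w →
        con 1 :+ (σ :+ β) :+ (w :+ g)
        := con 0 :+ (con 1 :+ (σ :+ β :+ w :+ g))) refl σ β g w)))

  -- Now the second inequality is the tight one: g ≤ β + w and σ - x = w + 1 cost at most β + 2w +
  -- 2, which β + g′ covers.
  gain-below : ∀ w → σ ≡ suc x + w → Dist x R g → 5 * w + 2 ≤ g′ → Gain x g g′
  gain-below {x} {g} {g′} w refl (inj₁ refl) far =
    ⊥-elim (1+n≰n {0} (linear-≤ (w + g) σ≤R
      (solve 3 (λ g R w →
        con 1 :+ R :+ (w :+ g)
        := con 0 :+ (con 1 :+ (R :+ g) :+ w)) refl g R w)))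
  gain-below {x} {g} {g′} w refl (inj₂ refl) far =
      linear-≤ (1 + β + 5 * w) (R≤σ+β ⊕ far)
        (solve 5 (λ x β g g′ w →
          g :+ x :+ con 2 :+ (con 1 :+ x :+ w :+ β :+ g′) :+ (con 1 :+ β :+ con 5 :* w)
          := con 2 :* β :+ g′ :+ (con 1 :+ x :+ w) :+ (con 1 :+ (x :+ g) :+ (con 5 :* w :+ con 2)))
         refl x β g g′ w)
    , linear-≤ (3 * w) (R≤σ+β ⊕ far)
        (solve 5 (λ x β g g′ w →
          g :+ (con 1 :+ x :+ w) :+ con 1 :+ (con 1 :+ x :+ w :+ β :+ g′) :+ con 3 :* w
          := β :+ g′ :+ x :+ (con 1 :+ (x :+ g) :+ (con 5 :* w :+ con 2))) refl x β g g′ w)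

  -- The split is by the half-open interval from `σ` to `σ + β`. The end `x = σ + β` counts as lying
  -- above, with `w = 0`; so does `x = σ` on a level without border vertices.
  gain : Dist x R g → Dist (q * x + 2) R′ g′ → Gain x g g′
  gain {x} D D′ with σ ≤? x | suc x ≤? σ + β
  ... | yes σ≤x | yes x<σ+β = gain-inside σ≤x x<σ+β D
  ... | no  σ≰x | _ with m≤n⇒∃[o]m+o≡n (≰⇒> σ≰x)
  ...   | w , eq = gain-below w (sym eq) D
                     (dist-above w 5≤q (subst (λ z → q * z ≤ R′) (sym eq) qσ≤R′) D′)
  gain {x} D D′ | yes _ | no x≮ with m≤n⇒∃[o]m+o≡n (≮⇒≥ x≮)
  ...   | w , refl = gain-above w refl D (dist-below w 5≤q R′≤q[σ+β] D′)

-- The invariants along all levels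

module _ (q d : ℕ) (5≤q : 5 ≤ q) (σ β : ℕ → ℕ) (σ₀≤1 : σ 0 ≤ 1)
         (down : ∀ i → i < d → q * σ i ≤ σ (suc i) + β (suc i))
         (up : ∀ i → i < d → σ (suc i) ≤ q * (σ i + β i)) where

  -- mid counts level i of S together with the border vertices regarded as belonging to S.
  record Inv (i : ℕ) : Set where
    field
      mid gap : ℕ
      lower : σ i ≤ mid
      upper : mid ≤ σ i + β i
      near  : Dist (profile q i) mid gap
      inv₁  : sum< (profile q) i + 2 * i ≤ 2 * sum< β i + gap + sum< σ i
      inv₂  : sum< σ i + i ≤ sum< β i + gap + sum< (profile q) i

  inv-zero : Inv 0
  inv-zero = record
    { mid = σ 0 ; gap = 0 ; lower = ≤-refl ; upper = m≤m+n _ _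
    ; near = D₀ σ₀≤1 ; inv₁ = z≤n ; inv₂ = z≤n }
    where
    -- By the shift of one half in `Dist`, both possible values of `σ 0` are at distance 0 from the
    -- target 0.
    D₀ : ∀ {R} → R ≤ 1 → Dist 0 R 0
    D₀ z≤n       = inj₁ refl
    D₀ (s≤s z≤n) = inj₂ refl

  -- Two intervals that meet share the larger of their left ends, hence the maximum chosen as `mid`;
  -- `down` and `up` put it below both right ends.
  inv-suc : ∀ i → i < d → Inv i → Inv (suc i)
  inv-suc i i<d I with dist (profile q (suc i)) (q * σ i ⊔ σ (suc i))
  ... | g′ , D′ = record
    { mid = q * σ i ⊔ σ (suc i) ; gap = g′ ; lower = m≤n⊔m _ _
    ; upper = ⊔-lub (down i i<d) (m≤m+n _ _)
    ; near = D′
    ; inv₁ = add₁ (sum< (profile q) i) (sum< β i) (sum< σ i) (profile q i) (β i) (σ i)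
               inv₁ (proj₁ G)
    ; inv₂ = add₂ (sum< (profile q) i) (sum< β i) (sum< σ i) (profile q i) (β i) (σ i)
               inv₂ (proj₂ G)
    }
    where
    open Inv I
    G = gain 5≤q lower upper (m≤m⊔n (q * σ i) (σ (suc i)))
          (⊔-lub (*-monoʳ-≤ q (m≤m+n (σ i) (β i))) (up i i<d)) near D′
    add₁ : ∀ X B S x b s → X + 2 * i ≤ 2 * B + gap + S → gap + x + 2 ≤ 2 * b + g′ + s →
           X + x + 2 * suc i ≤ 2 * (B + b) + g′ + (S + s)
    add₁ X B S x b s p r =
      linear-≤ 0 (p ⊕ r)
        (solve 9 (λ X B S x b s i gap g′ →
          X :+ x :+ con 2 :* (con 1 :+ i) :+ (con 2 :* B :+ gap :+ S :+ (con 2 :* b :+ g′ :+ s)) :+ con 0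
          := con 2 :* (B :+ b) :+ g′ :+ (S :+ s) :+ (X :+ con 2 :* i :+ (gap :+ x :+ con 2)))
         refl X B S x b s i gap g′)
    add₂ : ∀ X B S x b s → S + i ≤ B + gap + X → gap + s + 1 ≤ b + g′ + x →
           S + s + suc i ≤ B + b + g′ + (X + x)
    add₂ X B S x b s p r =
      linear-≤ 0 (p ⊕ r)
        (solve 9 (λ X B S x b s i gap g′ →
          S :+ s :+ (con 1 :+ i) :+ (B :+ gap :+ X :+ (b :+ g′ :+ x)) :+ con 0
          := B :+ b :+ g′ :+ (X :+ x) :+ (S :+ i :+ (gap :+ s :+ con 1)))
         refl X B S x b s i gap g′)

  inv : ∀ i → i ≤ d → Inv i
  inv zero    _   = inv-zero
  inv (suc i) i<d = inv-suc i i<d (inv i (<⇒≤ i<d))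

  -- Equal totals turn X - S into s - x. If R ≤ x, then x - s ≥ g, which cancels the gap in the
  -- second invariant. If R > x, then s - x ≥ g + 1 - b, which cancels it in the first at the price
  -- of `b`, and the doubled claim follows.
  final : ∀ {R g} X B S x b s → X + x ≡ S + s → s ≤ R → R ≤ s + b → Dist x R g →
          X + 2 * d ≤ 2 * B + g + S → S + d ≤ B + g + X → d ≤ B + b
  final {R} {g} X B S x b s eq s≤R R≤ (inj₁ refl) p₁ p₂ =
    linear-≤ b (≤-reflexive eq ⊕ s≤R ⊕ p₂)
      (solve 8 (λ X B S R b s g d →
        d :+ (S :+ s :+ (R :+ (B :+ g :+ X))) :+ b
        := B :+ b :+ (X :+ (R :+ g) :+ (s :+ (S :+ d)))) refl X B S R b s g d)
  final {R} {g} X B S x b s eq s≤R R≤ (inj₂ refl) p₁ p₂ = *-cancelˡ-≤ 2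
    (linear-≤ (1 + b) (≤-reflexive (sym eq) ⊕ R≤ ⊕ p₁)
      (solve 8 (λ X B S x b s g d →
        con 2 :* d :+ (X :+ x :+ (s :+ b :+ (con 2 :* B :+ g :+ S))) :+ (con 1 :+ b)
        := con 2 :* (B :+ b) :+ (S :+ s :+ (con 1 :+ (x :+ g) :+ (X :+ con 2 :* d))))
       refl X B S x b s g d))

  border-sum-≥ : sum< σ (suc d) ≡ sum< (profile q) (suc d) → d ≤ sum< β (suc d)
  border-sum-≥ eq =
    final (sum< (profile q) d) (sum< β d) (sum< σ d) (profile q d) (β d) (σ d)
      (sym eq) lower upper near inv₁ inv₂
    where open Inv (inv d ≤-refl)

-- Ensures that the critical size does not exceed the size of the tree. Strictness carries the
-- induction: it leaves room for a further `q`, more than the added 2.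
profile<^ : 5 ≤ q → ∀ i → profile q i < q ^ i
profile<^ 5≤q zero = s≤s z≤n
profile<^ {q} 5≤q (suc i) = aux (profile q i) (profile<^ 5≤q i)
  where
  aux : ∀ x {y} → x < y → q * x + 2 < q * y
  aux x x<y = ≤-trans (linear-≤ 2 5≤q
    (solve 2 (λ q x →
      con 1 :+ (q :* x :+ con 2) :+ q :+ con 2
      := q :* (con 1 :+ x) :+ con 5) refl q x)) (*-monoʳ-≤ q x<y)

-- Counting

bit : Bool → ℕ
bit true  = 1
bit false = 0

count : (ℕ → Bool) → ℕ → ℕ → ℕ
count f a zero    = 0
count f a (suc n) = bit (f a) + count f (suc a) n

In : ℕ → ℕ → ℕ → Set
In a n k = (a ≤ k) × (k < a + n)

in-head : ∀ a n → In a (suc n) a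
in-head a n = ≤-refl , m<m+n a (s≤s z≤n)

in-tail : ∀ {a n k} → In (suc a) n k → In a (suc n) k
in-tail {a} {n} (p , r) = <⇒≤ p , ≤-trans r (≤-reflexive (sym (+-suc a n)))

bit-mono : ∀ b c → (T b → T c) → bit b ≤ bit c
bit-mono false c     f = z≤n
bit-mono true  true  f = ≤-refl
bit-mono true  false f = ⊥-elim (f tt)

bit-∨ : ∀ b c → bit (b ∨ c) ≤ bit b + bit c
bit-∨ true  c = s≤s z≤n
bit-∨ false c = ≤-refl

bit-false : ∀ b → ¬ T b → bit b ≡ 0
bit-false true  h = ⊥-elim (h tt)
bit-false false h = refl

bit≤1 : ∀ b → bit b ≤ 1
bit≤1 true  = ≤-refl
bit≤1 false = z≤n

count-+ : ∀ f a m n → count f a (m + n) ≡ count f a m + count f (a + m) n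
count-+ f a zero    n = cong (λ z → count f z n) (sym (+-identityʳ a))
count-+ f a (suc m) n rewrite count-+ f (suc a) m n | +-suc a m =
  sym (+-assoc (bit (f a)) _ _)

count-∘suc : ∀ f a n → count (f ∘ suc) a n ≡ count f (suc a) n
count-∘suc f a zero    = refl
count-∘suc f a (suc n) = cong (bit (f (suc a)) +_) (count-∘suc f (suc a) n)

count-∨ : ∀ f g a n → count (λ k → f k ∨ g k) a n ≤ count f a n + count g a n
count-∨ f g a zero    = z≤n
count-∨ f g a (suc n) = aux (bit (f a)) (bit (g a)) (count f (suc a) n) (count g (suc a) n)
                          (bit-∨ (f a) (g a)) (count-∨ f g (suc a) n)
  where
  aux : ∀ {x y} b c m k → x ≤ b + c → y ≤ m + k → x + y ≤ b + m + (c + k)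
  aux {x} {y} b c m k p r = ≤-trans (p ⊕ r) (≤-reflexive (interchange b c m k))

count-≤ : ∀ f a n → count f a n ≤ n
count-≤ f a zero    = z≤n
count-≤ f a (suc n) = bit≤1 (f a) ⊕ count-≤ f (suc a) n

count-all : ∀ f a n → (∀ k → In a n k → T (f k)) → n ≤ count f a n
count-all f a zero    h = z≤n
count-all f a (suc n) h =
  bit-mono true (f a) (λ _ → h a (in-head a n)) ⊕ count-all f (suc a) n (λ k → h k ∘ in-tail)

count-none : ∀ f a n → (∀ k → In a n k → ¬ T (f k)) → count f a n ≡ 0
count-none f a zero    h = refl
count-none f a (suc n) h =
  cong₂ _+_ (bit-false (f a) (h a (in-head a n))) (count-none f (suc a) n (λ k → h k ∘ in-tail))

count-unique : ∀ f a n c → (∀ k → In a n k → T (f k) → k ≡ c) → count f a n ≤ 1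
count-unique f a zero    c h = z≤n
count-unique f a (suc n) c h with f a in eq
... | false = count-unique f (suc a) n c (λ k → h k ∘ in-tail)
... | true  = s≤s (≤-reflexive (count-none f (suc a) n λ k k∈ fk →
    <⇒≢ (proj₁ k∈) (trans (h a (in-head a n) (subst T (sym eq) tt)) (sym (h k (in-tail k∈) fk)))))

-- In the heap numbering the children of `a` come directly before those of `suc a`, so the children
-- of consecutive vertices fill one interval and can be counted parent by parent.
count-blocks : ∀ f q a n →
               count f (suc (q * a)) (q * suc n) ≡
               count f (suc (q * a)) q + count f (suc (q * suc a)) (q * n)
count-blocks f q a n rewrite *-suc q n | count-+ f (suc (q * a)) q (q * n)
                           | *-suc q a | +-comm q (q * a) = refl

count-children-≥ : ∀ f h q a n →
  (∀ k v → In a n k → In (suc (q * k)) q v → T (f k) → T (h v)) →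
  q * count f a n ≤ count h (suc (q * a)) (q * n)
count-children-≥ f h q a zero    _  rewrite *-zeroʳ q = z≤n
count-children-≥ f h q a (suc n) fh
  rewrite count-blocks h q a n | *-distribˡ-+ q (bit (f a)) (count f (suc a) n) =
  block (f a) (λ fa v v∈ → fh a v (in-head a n) v∈ fa)
    ⊕ count-children-≥ f h q (suc a) n (λ k v → fh k v ∘ in-tail)
  where
  block : ∀ b → (T b → ∀ v → In (suc (q * a)) q v → T (h v)) →
          q * bit b ≤ count h (suc (q * a)) q
  block false _ = ≤-trans (≤-reflexive (*-zeroʳ q)) z≤n
  block true  p = ≤-trans (≤-reflexive (*-identityʳ q)) (count-all h _ q (p tt))

count-children-≤ : ∀ f h q a n →
  (∀ k v → In a n k → In (suc (q * k)) q v → T (h v) → T (f k)) →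
  count h (suc (q * a)) (q * n) ≤ q * count f a n
count-children-≤ f h q a zero    _  rewrite *-zeroʳ q = z≤n
count-children-≤ f h q a (suc n) hf
  rewrite count-blocks h q a n | *-distribˡ-+ q (bit (f a)) (count f (suc a) n) =
  block (f a) (λ v → hf a v (in-head a n))
    ⊕ count-children-≤ f h q (suc a) n (λ k v → hf k v ∘ in-tail)
  where
  block : ∀ b → (∀ v → In (suc (q * a)) q v → T (h v) → T b) →
          count h (suc (q * a)) q ≤ q * bit b
  block false p = ≤-reflexive (trans (count-none h _ q p) (sym (*-zeroʳ q)))
  block true  p = ≤-trans (count-≤ h _ q) (≤-reflexive (sym (*-identityʳ q)))

-- Membership extended by `false` beyond `n`, so that counting and heap arithmetic can take place in
-- `ℕ`.
member : ∀ {n} → Subset n → ℕ → Bool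
member []      k       = false
member (b ∷ S) zero    = b
member (b ∷ S) (suc k) = member S k

member-toℕ : ∀ {n} (S : Subset n) i → member S (toℕ i) ≡ lookup S i
member-toℕ (b ∷ S) Fin.zero    = refl
member-toℕ (b ∷ S) (Fin.suc i) = member-toℕ S i

member-< : ∀ {n} (S : Subset n) k → T (member S k) → k < n
member-< (b ∷ S) zero    _ = s≤s z≤n
member-< (b ∷ S) (suc k) h = s≤s (member-< S k h)

member-++ˡ : ∀ {m n} (S : Subset m) (U : Subset n) k → k < m → member (S ++ U) k ≡ member S k
member-++ˡ (b ∷ S) U zero    _         = refl
member-++ˡ (b ∷ S) U (suc k) (s≤s k<m) = member-++ˡ S U k k<m

member-++ʳ : ∀ {m n} (S : Subset m) (U : Subset n) k → member (S ++ U) (m + k) ≡ member U k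
member-++ʳ []      U k = refl
member-++ʳ (b ∷ S) U k = member-++ʳ S U k

∣∣≡count : ∀ {n} (S : Subset n) → ∣ S ∣ ≡ count (member S) 0 n
∣∣≡count [] = refl
∣∣≡count {suc n} (true ∷ S)  = cong suc (trans (∣∣≡count S) (count-∘suc (member (true ∷ S)) 0 n))
∣∣≡count {suc n} (false ∷ S) = trans (∣∣≡count S) (count-∘suc (member (false ∷ S)) 0 n)

∣++∣ : ∀ {m n} (S : Subset m) (U : Subset n) → ∣ S ++ U ∣ ≡ ∣ S ∣ + ∣ U ∣
∣++∣ []          U = refl
∣++∣ (true ∷ S)  U = cong suc (∣++∣ S U)
∣++∣ (false ∷ S) U = ∣++∣ S U

-- Borders

anyFin-intro : ∀ {n} (f : Fin n → Bool) i → T (f i) → T (anyFin f)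
anyFin-intro f Fin.zero fi with f Fin.zero
... | true = tt
anyFin-intro f (Fin.suc i) fi with f Fin.zero
... | true  = tt
... | false = anyFin-intro (f ∘ Fin.suc) i fi

anyFin-elim : ∀ {n} (f : Fin n → Bool) → T (anyFin f) → ∃ λ i → T (f i)
anyFin-elim {suc n} f h with f Fin.zero in eq
... | true  = Fin.zero , subst T (sym eq) tt
... | false with anyFin-elim (f ∘ Fin.suc) h
...   | i , fi = Fin.suc i , fi

∧-intro : ∀ b c → T b → T c → T (b ∧ c)
∧-intro true true _ _ = tt

∧-elim : ∀ b c → T (b ∧ c) → T b × T c
∧-elim true true _ = tt , tt

∨-introˡ : ∀ b c → T b → T (b ∨ c)
∨-introˡ true c _ = tt

∨-introʳ : ∀ b c → T c → T (b ∨ c)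
∨-introʳ true  c _ = tt
∨-introʳ false c h = h

∨-elim : ∀ b c → T (b ∨ c) → T b ⊎ T c
∨-elim true  c _ = inj₁ tt
∨-elim false c h = inj₂ h

not-elim : ∀ b → T (not b) → ¬ T b
not-elim false _ ()

b∨[¬b∧c] : ∀ b c → T c → T (b ∨ (not b ∧ c))
b∨[¬b∧c] true  c h = tt
b∨[¬b∧c] false c h = h

Child : ℕ → ℕ → ℕ → Set
Child q u v = (q * u < v) × (v ≤ q * u + q)

child⇒parentB : ∀ q u v → Child q u v → T (parentB q u v)
child⇒parentB q u v (p , r) = ∧-intro _ _ (<⇒<ᵇ p) (≤⇒≤ᵇ r)

parentB⇒child : ∀ q u v → T (parentB q u v) → Child q u v
parentB⇒child q u v h with ∧-elim (q * u <ᵇ v) (v ≤ᵇ q * u + q) h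
... | p , r = <ᵇ⇒< _ _ p , ≤ᵇ⇒≤ _ _ r

module _ (q d : ℕ) (S : Subset (treeSize q d)) where

  private
    B = border (treeAdj q d) S

  member-border : ∀ v → member B (toℕ v) ≡
    not (member S (toℕ v)) ∧ anyFin (λ u → lookup S u ∧ treeAdj q d u v)
  member-border v rewrite member-toℕ S v = trans (member-toℕ B v) (lookup∘tabulate _ v)

  neighbour-covered : ∀ u v → v < treeSize q d → Child q u v ⊎ Child q v u →
                      T (member S u) → T (member S v ∨ member B v)
  -- The claim is proved for numbers of the form `toℕ i`, where `border` computes, and transported
  -- to `u` and `v`, which are both in range.
  neighbour-covered u v v<n uv u∈S = subst₂ P (toℕ-fromℕ< u<n) (toℕ-fromℕ< v<n) fin uv u∈S
    where
    u<n = member-< S u u∈S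
    P : ℕ → ℕ → Set
    P a b = Child q a b ⊎ Child q b a → T (member S a) → T (member S b ∨ member B b)
    adj : ∀ a b → Child q a b ⊎ Child q b a → T (parentB q a b ∨ parentB q b a)
    adj a b (inj₁ ab) = ∨-introˡ _ _ (child⇒parentB q a b ab)
    adj a b (inj₂ ba) = ∨-introʳ (parentB q a b) _ (child⇒parentB q b a ba)
    fin : ∀ {i j} → P (toℕ i) (toℕ j)
    fin {i} {j} ij i∈S = subst (λ b → T (member S (toℕ j) ∨ b)) (sym (member-border j))
      (b∨[¬b∧c] (member S (toℕ j)) _ (anyFin-intro _ i
        (∧-intro _ _ (subst T (member-toℕ S i) i∈S) (adj (toℕ i) (toℕ j) ij))))

  border-elim : ∀ v → T (member B v) →
    ¬ T (member S v) × ∃ λ u → T (member S u) × (Child q u v ⊎ Child q v u)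
  border-elim v v∈B = subst P (toℕ-fromℕ< v<n) fin v∈B
    where
    v<n = member-< B v v∈B
    P : ℕ → Set
    P b = T (member B b) → ¬ T (member S b) × ∃ λ u → T (member S u) × (Child q u b ⊎ Child q b u)
    fin : ∀ {j} → P (toℕ j)
    fin {j} j∈B with ∧-elim _ _ (subst T (member-border j) j∈B)
    ... | j∉S , any with anyFin-elim _ any
    ... | i , h with ∧-elim (lookup S i) _ h
    ... | i∈S , ij = not-elim _ j∉S , toℕ i , subst T (sym (member-toℕ S i)) i∈S , child ij
      where
      child : T (treeAdj q d i j) → Child q (toℕ i) (toℕ j) ⊎ Child q (toℕ j) (toℕ i)
      child ij with ∨-elim (parentB q (toℕ i) (toℕ j)) _ ij
      ... | inj₁ h = inj₁ (parentB⇒child q (toℕ i) (toℕ j) h)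
      ... | inj₂ h = inj₂ (parentB⇒child q (toℕ j) (toℕ i) h)

-- Levels

first : ℕ → ℕ → ℕ
first q zero    = 0
first q (suc i) = treeSize q i

first+^ : ∀ q i → first q i + q ^ i ≡ treeSize q i
first+^ q zero    = refl
first+^ q (suc i) = refl

-- The vertices up to level i are the root and the children of the vertices before level i. Read as
-- a vertex number, this says that level i + 1 starts with the first child of the first vertex of
-- level i.
treeSize≡ : ∀ q i → treeSize q i ≡ suc (q * first q i)
treeSize≡ q zero    = cong suc (sym (*-zeroʳ q))
treeSize≡ q (suc i) = begin
  treeSize q i + q * q ^ i           ≡⟨ cong (_+ q * q ^ i) (treeSize≡ q i) ⟩
  suc (q * first q i + q * q ^ i)    ≡⟨ cong suc (sym (*-distribˡ-+ q (first q i) (q ^ i))) ⟩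
  suc (q * (first q i + q ^ i))      ≡⟨ cong (suc ∘ (q *_)) (first+^ q i) ⟩
  suc (q * treeSize q i)             ∎
  where open ≡-Reasoning

treeSize-mono : ∀ q {i d} → i ≤ d → treeSize q i ≤ treeSize q d
treeSize-mono q {i} {d} i≤d = go (≤⇒≤′ i≤d)
  where
  go : ∀ {d} → i ≤′ d → treeSize q i ≤ treeSize q d
  go ≤′-refl     = ≤-refl
  go (≤′-step p) = ≤-trans (go p) (m≤m+n _ _)

level-< : ∀ q {i d o} → i ≤ d → o < q ^ i → first q i + o < treeSize q d
level-< q {i} {d} i≤d o< = <-≤-trans (+-monoʳ-< (first q i) o<)
  (subst (_≤ treeSize q d) (sym (first+^ q i)) (treeSize-mono q i≤d))

count-levels : ∀ f q d →
  count f 0 (treeSize q d) ≡ sum< (λ i → count f (first q i) (q ^ i)) (suc d)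
count-levels f q zero    = refl
count-levels f q (suc d) =
  trans (count-+ f 0 (treeSize q d) (q ^ suc d))
    (cong (_+ count f (treeSize q d) (q ^ suc d)) (count-levels f q d))

sum<-^ : ∀ q d → sum< (q ^_) (suc d) ≡ treeSize q d
sum<-^ q zero    = refl
sum<-^ q (suc d) = cong (_+ q ^ suc d) (sum<-^ q d)

level-count : ∀ {n} → ℕ → Subset n → ℕ → ℕ
level-count q S i = count (member S) (first q i) (q ^ i)

∣∣≡levels : ∀ q d (S : Subset (treeSize q d)) → ∣ S ∣ ≡ sum< (level-count q S) (suc d)
∣∣≡levels q d S = trans (∣∣≡count S) (count-levels (member S) q d)

in-block⇒child : ∀ q k v → In (suc (q * k)) q v → Child q k v
in-block⇒child q k v (p , s≤s r) = p , r

in-level-< : ∀ q {i d k} → i ≤ d → In (first q i) (q ^ i) k → k < treeSize q d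
in-level-< q {i} i≤d (_ , k<) =
  <-≤-trans k< (subst (_≤ _) (sym (first+^ q i)) (treeSize-mono q i≤d))

in-level-suc : ∀ q i {k v} → In (first q i) (q ^ i) k → Child q k v →
               In (first q (suc i)) (q ^ suc i) v
in-level-suc q i {k} {v} (a≤k , k<) (qk<v , v≤) =
    ≤-trans (≤-reflexive (treeSize≡ q i)) (≤-trans (s≤s (*-monoʳ-≤ q a≤k)) qk<v)
  , (begin
      suc v                            ≤⟨ s≤s v≤ ⟩
      suc (q * k + q)                  ≡⟨ cong suc (trans (+-comm (q * k) q) (sym (*-suc q k))) ⟩
      suc (q * suc k)                  ≤⟨ s≤s (*-monoʳ-≤ q k<) ⟩
      suc (q * (first q i + q ^ i))    ≡⟨ cong (suc ∘ (q *_)) (first+^ q i) ⟩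
      suc (q * treeSize q i)           ≡⟨ sym (treeSize≡ q (suc i)) ⟩
      treeSize q i + q ^ suc i         ∎)
  where open ≤-Reasoning

-- Level inequalities for a vertex set and the lower bound

module _ (q d : ℕ) (S : Subset (treeSize q d)) where

  private
    B = border (treeAdj q d) S
    |S| = level-count q S
    |B| = level-count q B

  level-down : ∀ i → i < d → q * |S| i ≤ |S| (suc i) + |B| (suc i)
  level-down i i<d = ≤-trans
    (subst (λ a → q * |S| i ≤ count (λ k → member S k ∨ member B k) a (q ^ suc i))
      (sym (treeSize≡ q i))
      (count-children-≥ (member S) _ q (first q i) (q ^ i) λ k v k∈ v∈ k∈S →
        let kv = in-block⇒child q k v v∈ in
        neighbour-covered q d S k v (in-level-< q i<d (in-level-suc q i k∈ kv)) (inj₁ kv) k∈S))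
    (count-∨ (member S) (member B) (treeSize q i) (q ^ suc i))

  level-up : ∀ i → i < d → |S| (suc i) ≤ q * (|S| i + |B| i)
  level-up i i<d = ≤-trans
    (subst (λ a → count (member S) a (q ^ suc i) ≤
                  q * count (λ k → member S k ∨ member B k) (first q i) (q ^ i))
      (sym (treeSize≡ q i))
      (count-children-≤ (λ k → member S k ∨ member B k) (member S) q (first q i) (q ^ i)
        λ k v k∈ v∈ v∈S →
          neighbour-covered q d S v k (in-level-< q (<⇒≤ i<d) k∈)
            (inj₂ (in-block⇒child q k v v∈)) v∈S))
    (*-monoʳ-≤ q (count-∨ (member S) (member B) (first q i) (q ^ i)))

critical-size : ℕ → ℕ → ℕ
critical-size q d = sum< (profile q) (suc d)

critical-size≤ : ∀ q d → 5 ≤ q → critical-size q d ≤ treeSize q d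
critical-size≤ q d 5≤q = subst (critical-size q d ≤_) (sum<-^ q d)
  (sum<-mono (profile q) (q ^_) (suc d) (λ i _ → <⇒≤ (profile<^ 5≤q i)))

border-≥ : ∀ q d → 5 ≤ q → (S : Subset (treeSize q d)) → ∣ S ∣ ≡ critical-size q d →
           d ≤ ∣ border (treeAdj q d) S ∣
border-≥ q d 5≤q S eq = subst (d ≤_) (sym (∣∣≡levels q d (border (treeAdj q d) S)))
  (border-sum-≥ q d 5≤q (level-count q S) (level-count q (border (treeAdj q d) S))
    (count-≤ (member S) 0 1) (level-down q d S) (level-up q d S)
    (trans (sym (∣∣≡levels q d S)) eq))

-- Initial segments of the postorder

-- Conditions met by the level counts of a postorder initial segment in a forest of `b` complete
-- trees of depth `h`: the chosen roots have all their children chosen, and beyond these there is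
-- room for the children of only one more root.
Segment : ℕ → ℕ → ℕ → (ℕ → ℕ) → Set
Segment q b zero    σ = σ 0 ≤ b
Segment q b (suc h) σ =
  σ 0 ≤ b × q * σ 0 ≤ σ 1 × σ 1 ≤ q * σ 0 + q × Segment q (q * b) h (σ ∘ suc)

infixr 5 _◂_
_◂_ : ℕ → (ℕ → ℕ) → ℕ → ℕ
(a ◂ σ) zero    = a
(a ◂ σ) (suc i) = σ i

segment-zero : ∀ q b h → Segment q b h (λ _ → 0)
segment-zero q b zero    = z≤n
segment-zero q b (suc h) = z≤n , ≤-reflexive (*-zeroʳ q) , z≤n , segment-zero q (q * b) h

-- One step of the postorder: the next root is added once its children are complete, otherwise the
-- step happens in the forest below the roots. The bounds on `τ 0` preserve the inequalities with
-- the level above.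
segment-next : ∀ q b h σ → Segment q b h σ → σ 0 < b →
  ∃ λ τ → Segment q b h τ × sum< τ (suc h) ≡ suc (sum< σ (suc h)) ×
          σ 0 ≤ τ 0 × τ 0 ≤ suc (σ 0)
segment-next q b zero σ _ σ₀<b = (λ _ → suc (σ 0)) , σ₀<b , refl , n≤1+n _ , ≤-refl
segment-next q b (suc h) σ (σ₀≤b , lo , hi , seg) σ₀<b with suc (σ 1) ≤? q * σ 0 + q
... | no full =
    suc (σ 0) ◂ (σ ∘ suc)
  , ( σ₀<b
    , ≤-trans (≤-reflexive (trans (*-suc q (σ 0)) (+-comm q _))) (≮⇒≥ full)
    , ≤-trans hi (+-monoˡ-≤ q (*-monoʳ-≤ q (n≤1+n (σ 0))))
    , seg)
  , trans (sum<-suc (suc (σ 0) ◂ (σ ∘ suc)) (suc h)) (cong suc (sym (sum<-suc σ (suc h))))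
  , n≤1+n _ , ≤-refl
... | yes room with segment-next q (q * b) h (σ ∘ suc) seg
  (≤-trans room (≤-trans
    (≤-reflexive (sym (trans (*-suc q (σ 0)) (+-comm q _))))
    (*-monoʳ-≤ q σ₀<b)))
...   | τ , seg′ , sum≡ , σ₁≤τ₀ , τ₀≤ =
    σ 0 ◂ τ
  , (σ₀≤b , ≤-trans lo σ₁≤τ₀ , ≤-trans τ₀≤ room , seg′)
  , (begin
      sum< (σ 0 ◂ τ) (2 + h)               ≡⟨ sum<-suc (σ 0 ◂ τ) (suc h) ⟩
      σ 0 + sum< τ (suc h)                 ≡⟨ cong (σ 0 +_) sum≡ ⟩
      σ 0 + suc (sum< (σ ∘ suc) (suc h))   ≡⟨ +-suc (σ 0) _ ⟩
      suc (σ 0 + sum< (σ ∘ suc) (suc h))   ≡⟨ cong suc (sym (sum<-suc σ (suc h))) ⟩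
      suc (sum< σ (2 + h))                 ∎)
  , ≤-refl , n≤1+n _
  where open ≡-Reasoning

-- Being full passes down from level to level. Hence a segment containing the root is the whole
-- tree, and every smaller one can be extended.
segment-full : ∀ q b h σ → Segment q b h σ → b ≤ σ 0 → b * treeSize q h ≤ sum< σ (suc h)
segment-full q b zero σ _ b≤σ₀ = ≤-trans (≤-reflexive (*-identityʳ b)) b≤σ₀
segment-full q b (suc h) σ (_ , lo , _ , seg) b≤σ₀ = begin
  b * treeSize q (suc h)            ≡⟨ cong (b *_) (treeSize≡ q (suc h)) ⟩
  b * suc (q * treeSize q h)        ≡⟨ *-suc b _ ⟩
  b + b * (q * treeSize q h)        ≡⟨ cong (b +_) (trans (sym (*-assoc b q _))
                                         (cong (_* treeSize q h) (*-comm b q))) ⟩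
  b + (q * b) * treeSize q h        ≤⟨ b≤σ₀ ⊕ segment-full q (q * b) h (σ ∘ suc) seg
                                               (≤-trans (*-monoʳ-≤ q b≤σ₀) lo) ⟩
  σ 0 + sum< (σ ∘ suc) (suc h)      ≡⟨ sym (sum<-suc σ (suc h)) ⟩
  sum< σ (2 + h)                    ∎
  where open ≤-Reasoning

segment-of-size : ∀ q d s → s ≤ treeSize q d → ∃ λ σ → Segment q 1 d σ × sum< σ (suc d) ≡ s
segment-of-size q d zero    _   = (λ _ → 0) , segment-zero q 1 d , zeros (suc d)
  where
  zeros : ∀ n → sum< (λ _ → 0) n ≡ 0
  zeros zero    = refl
  zeros (suc n) = cong (_+ 0) (zeros n)
segment-of-size q d (suc s) s<n with segment-of-size q d s (<⇒≤ s<n)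
... | σ , seg , sum≡ with suc (σ 0) ≤? 1
...   | no full = ⊥-elim (<-irrefl (sym sum≡) (<-≤-trans s<n
          (subst (_≤ sum< σ (suc d)) (*-identityˡ (treeSize q d))
            (segment-full q 1 d σ seg (≤-pred (≰⇒> full))))))
...   | yes room with segment-next q 1 d σ seg room
...     | τ , seg′ , sum≡′ , _ = τ , seg′ , trans sum≡′ (cong suc sum≡)

segment-bound : ∀ q b h σ → Segment q b h σ → ∀ i → i ≤ h → σ i ≤ q ^ i * b
segment-bound q b zero    σ seg zero _ = ≤-trans seg (≤-reflexive (sym (*-identityˡ b)))
segment-bound q b (suc h) σ seg zero _ = ≤-trans (proj₁ seg) (≤-reflexive (sym (*-identityˡ b)))
segment-bound q b (suc h) σ (_ , _ , _ , seg) (suc i) (s≤s i≤h) =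
  ≤-trans (segment-bound q (q * b) h (σ ∘ suc) seg i i≤h) (≤-reflexive
    (trans (sym (*-assoc (q ^ i) q b)) (cong (_* b) (*-comm (q ^ i) q))))

segment-step : ∀ q b h σ → Segment q b h σ → ∀ i → i < h →
               q * σ i ≤ σ (suc i) × σ (suc i) ≤ q * σ i + q
segment-step q b (suc h) σ (_ , lo , hi , _) zero    _         = lo , hi
segment-step q b (suc h) σ (_ , _ , _ , seg) (suc i) (s≤s i<h) =
  segment-step q (q * b) h (σ ∘ suc) seg i i<h

-- Vertex sets realising the segments, and their borders

initial : ∀ n → ℕ → Subset n
initial zero    s       = []
initial (suc n) zero    = false ∷ initial n zero
initial (suc n) (suc s) = true ∷ initial n s

∣initial∣ : ∀ n s → s ≤ n → ∣ initial n s ∣ ≡ s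
∣initial∣ zero    zero    _         = refl
∣initial∣ (suc n) zero    _         = ∣initial∣ n zero z≤n
∣initial∣ (suc n) (suc s) (s≤s s≤n) = cong suc (∣initial∣ n s s≤n)

member-initial : ∀ n s k → T (member (initial n s) k) → k < s
member-initial (suc n) zero    (suc k) h with () ← member-initial n zero k h
member-initial (suc n) (suc s) zero    h = s≤s z≤n
member-initial (suc n) (suc s) (suc k) h = s≤s (member-initial n s k h)

initial-member : ∀ n s k → k < n → k < s → T (member (initial n s) k)
initial-member (suc n) (suc s) zero    _         _         = tt
initial-member (suc n) (suc s) (suc k) (s≤s k<n) (s≤s k<s) = initial-member n s k k<n k<s

-- Levels are consecutive in the heap numbering, so concatenation selects the leftmost `σ i`
-- vertices of each level.
segment-set : ∀ q d → (ℕ → ℕ) → Subset (treeSize q d)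
segment-set q zero    σ = initial 1 (σ 0)
segment-set q (suc d) σ = segment-set q d σ ++ initial (q ^ suc d) (σ (suc d))

∣segment-set∣ : ∀ q d σ → (∀ i → i ≤ d → σ i ≤ q ^ i) →
                ∣ segment-set q d σ ∣ ≡ sum< σ (suc d)
∣segment-set∣ q zero    σ bd = ∣initial∣ 1 (σ 0) (bd 0 z≤n)
∣segment-set∣ q (suc d) σ bd = trans (∣++∣ (segment-set q d σ) _)
  (cong₂ _+_ (∣segment-set∣ q d σ (λ i i≤d → bd i (m≤n⇒m≤1+n i≤d)))
             (∣initial∣ (q ^ suc d) (σ (suc d)) (bd (suc d) ≤-refl)))

member-segment-set : ∀ q d σ i o → i ≤ d → o < q ^ i →
  member (segment-set q d σ) (first q i + o) ≡ member (initial (q ^ i) (σ i)) o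
member-segment-set q d σ i o i≤d o< = go d (≤⇒≤′ i≤d)
  where
  go : ∀ d → i ≤′ d →
       member (segment-set q d σ) (first q i + o) ≡ member (initial (q ^ i) (σ i)) o
  go zero    ≤′-refl     = refl
  go (suc d) ≤′-refl     = member-++ʳ (segment-set q d σ) _ o
  go (suc d) (≤′-step p) =
    trans (member-++ˡ (segment-set q d σ) _ _ (level-< q (≤′⇒≤ p) o<)) (go d p)

in-offset : ∀ {a n k} → In a n k → ∃ λ o → k ≡ a + o × o < n
in-offset {a} {n} {k} (a≤k , k<) with m≤n⇒∃[o]m+o≡n a≤k
... | o , refl = o , refl , +-cancelˡ-< a o n k<

child-offset : ∀ q i {o o′} → Child q (first q i + o) (first q (suc i) + o′) →
               q * o ≤ o′ × o′ < q * o + q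
child-offset q i {o} {o′} (p , r) rewrite treeSize≡ q i | *-distribˡ-+ q (first q i) o =
    +-cancelˡ-≤ (q * first q i) (q * o) o′ (≤-pred p)
  , +-cancelˡ-≤ (q * first q i) (suc o′) (q * o + q)
      (≤-trans (≤-reflexive (+-suc _ o′)) (≤-trans r (≤-reflexive (+-assoc (q * first q i) _ q))))

in-level-pred : ∀ q i {k v} → In (first q (suc i)) (q ^ suc i) v → Child q k v →
                In (first q i) (q ^ i) k
in-level-pred q i {k} {v} (a≤v , v<) (qk<v , v≤) =
    ≤-pred (*-cancelˡ-< q (first q i) (suc k) (begin-strict
      q * first q i        <⟨ ≤-reflexive (sym (treeSize≡ q i)) ⟩
      treeSize q i         ≤⟨ a≤v ⟩
      v                    ≤⟨ v≤ ⟩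
      q * k + q            ≡⟨ trans (+-comm (q * k) q) (sym (*-suc q k)) ⟩
      q * suc k            ∎))
  , *-cancelˡ-< q k (first q i + q ^ i) (begin-strict
      q * k                        <⟨ qk<v ⟩
      v                            ≤⟨ ≤-pred (≤-trans v< (≤-reflexive (treeSize≡ q (suc i)))) ⟩
      q * treeSize q i             ≡⟨ cong (q *_) (sym (first+^ q i)) ⟩
      q * (first q i + q ^ i)      ∎)
  where open ≤-Reasoning

module _ (q d : ℕ) (σ : ℕ → ℕ)
         (step : ∀ i → i < d → q * σ i ≤ σ (suc i) × σ (suc i) ≤ q * σ i + q) where

  private
    S = segment-set q d σ
    B = border (treeAdj q d) S

  segment-< : ∀ i o → i ≤ d → o < q ^ i → T (member S (first q i + o)) → o < σ i
  segment-< i o i≤d o< h =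
    member-initial (q ^ i) (σ i) o (subst T (member-segment-set q d σ i o i≤d o<) h)

  segment-> : ∀ i o → i ≤ d → o < q ^ i → ¬ T (member S (first q i + o)) → σ i ≤ o
  segment-> i o i≤d o< h = ≮⇒≥ λ o<σ → h (subst T (sym (member-segment-set q d σ i o i≤d o<))
    (initial-member (q ^ i) (σ i) o o< o<σ))

  -- The set is closed under children: the first `σ i` vertices of a level have the first `q * σ i`
  -- of the next as children, and these are all chosen.
  parent-∉ : ∀ i v u → i ≤ d → In (first q i) (q ^ i) v → ¬ T (member S v) →
             T (member S u) → ¬ Child q u v
  parent-∉ zero    v u _   (_ , s≤s z≤n) _ _ (() , _)
  parent-∉ (suc i) v u i<d v∈ v∉S u∈S uv
    with in-offset (in-level-pred q i v∈ uv) | in-offset v∈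
  ... | o , refl , o< | o′ , refl , o′< =
    <-irrefl refl (begin-strict
      o′           <⟨ proj₂ (child-offset q i uv) ⟩
      q * o + q    ≡⟨ trans (+-comm (q * o) q) (sym (*-suc q o)) ⟩
      q * suc o    ≤⟨ *-monoʳ-≤ q (segment-< i o (<⇒≤ i<d) o< u∈S) ⟩
      q * σ i      ≤⟨ proj₁ (step i i<d) ⟩
      σ (suc i)    ≤⟨ segment-> (suc i) o′ i<d o′< v∉S ⟩
      o′           ∎)
    where open ≤-Reasoning

  -- At most `q * suc (σ i)` vertices are chosen on the next level, so a vertex with a chosen child
  -- has offset at most `σ i`; not being chosen, it has offset at least `σ i`.
  child-∈ : ∀ i v u → i < d → In (first q i) (q ^ i) v → ¬ T (member S v) →
            T (member S u) → Child q v u → v ≡ first q i + σ i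
  child-∈ i v u i<d v∈ v∉S u∈S vu with in-offset v∈ | in-offset (in-level-suc q i v∈ vu)
  ... | o , refl , o< | o′ , refl , o′< = cong (first q i +_) (≤-antisym
    (≤-pred (*-cancelˡ-< q o (suc (σ i)) (begin-strict
      q * o              ≤⟨ proj₁ (child-offset q i vu) ⟩
      o′                 <⟨ segment-< (suc i) o′ i<d o′< u∈S ⟩
      σ (suc i)          ≤⟨ proj₂ (step i i<d) ⟩
      q * σ i + q        ≡⟨ trans (+-comm (q * σ i) q) (sym (*-suc q (σ i))) ⟩
      q * suc (σ i)      ∎)))
    (segment-> i o (<⇒≤ i<d) o< v∉S))
    where open ≤-Reasoning

  border-level-≤1 : ∀ i → i < d → level-count q B i ≤ 1
  border-level-≤1 i i<d = count-unique (member B) (first q i) (q ^ i) (first q i + σ i) unique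
    where
    unique : ∀ v → In (first q i) (q ^ i) v → T (member B v) → v ≡ first q i + σ i
    unique v v∈ v∈B with border-elim q d S v v∈B
    ... | v∉S , u , u∈S , inj₁ uv = ⊥-elim (parent-∉ i v u (<⇒≤ i<d) v∈ v∉S u∈S uv)
    ... | v∉S , u , u∈S , inj₂ vu = child-∈ i v u i<d v∈ v∉S u∈S vu

  border-leaves : level-count q B d ≡ 0
  border-leaves = count-none (member B) (first q d) (q ^ d) none
    where
    none : ∀ v → In (first q d) (q ^ d) v → ¬ T (member B v)
    none v v∈ v∈B with border-elim q d S v v∈B
    ... | v∉S , u , u∈S , inj₁ uv = parent-∉ d v u ≤-refl v∈ v∉S u∈S uv
    -- A child of a leaf would have a number of at least `treeSize q d`, outside the tree.
    ... | v∉S , u , u∈S , inj₂ vu =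
      <⇒≱ (member-< S u u∈S) (proj₁ (in-level-suc q d v∈ vu))

  segment-border-≤ : ∣ B ∣ ≤ d
  segment-border-≤ = begin
    ∣ B ∣                                           ≡⟨ ∣∣≡levels q d B ⟩
    sum< (level-count q B) d + level-count q B d    ≡⟨ cong (sum< (level-count q B) d +_) border-leaves ⟩
    sum< (level-count q B) d + 0                    ≡⟨ +-identityʳ _ ⟩
    sum< (level-count q B) d                        ≤⟨ sum<-mono _ (λ _ → 1) d border-level-≤1 ⟩
    sum< (λ _ → 1) d                                ≡⟨ ones d ⟩
    d                                               ∎
    where
    open ≤-Reasoning
    ones : ∀ n → sum< (λ _ → 1) n ≡ n
    ones zero    = refl
    ones (suc n) = trans (cong (_+ 1) (ones n)) (+-comm n 1)

-- The isoperimetric peak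

small-border : ∀ q d s → s ≤ treeSize q d →
  ∃ λ (S : Subset (treeSize q d)) → ∣ S ∣ ≡ s × ∣ border (treeAdj q d) S ∣ ≤ d
small-border q d s s≤n with segment-of-size q d s s≤n
... | σ , seg , sum≡ =
    segment-set q d σ
  , trans (∣segment-set∣ q d σ λ i i≤d →
      subst (σ i ≤_) (*-identityʳ (q ^ i)) (segment-bound q 1 d σ seg i i≤d)) sum≡
  , segment-border-≤ q d σ (segment-step q 1 d σ seg)

theorem1p4 : (q d : ℕ) → 5 ≤ q → IsPhiVPeak (treeAdj q d) d
theorem1p4 q d 5≤q = (critical-size q d , s≤n , attained , border-≥ q d 5≤q) , peak
  where
  s≤n = critical-size≤ q d 5≤q
  attained : ∃ λ (S : Subset (treeSize q d)) →
             ∣ S ∣ ≡ critical-size q d × ∣ border (treeAdj q d) S ∣ ≡ d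
  attained with small-border q d (critical-size q d) s≤n
  ... | S , size , small = S , size , ≤-antisym small (border-≥ q d 5≤q S size)
  peak : ∀ s m → s ≤ treeSize q d → IsPhiV (treeAdj q d) s m → m ≤ d
  peak s m s≤ (_ , minimal) with small-border q d s s≤
  ... | S , size , small = ≤-trans (minimal S size) small
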